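{- Cantor's theorem holds in every extensive digraph.
   Context: A digraph is $D=\langle V,E\rangle$ with $V$ a nonempty set and $E\subseteq V\times V$; $uEv$ means $\langle u,v\rangle\in E$. $N(u)=\{v\in V: vEu\}$; elements of $N(u)$ are the $D$-elements of $u$. ZF formulas are first-order formulas with variables $x_1,x_2,\dots$, built from atomic formulas $(x_i\in x_j)$, $(x_i=x_j)$ using $\neg,\to,\leftrightarrow,\wedge,\vee$ and quantifiers $\exists x_k,\forall x_k$. $D\models\chi$, for a sentence $\chi$, is usual satisfaction with universe $V$, with $\in$ interpreted as $E$ and $=$ as equality. $D$ is extensive if the axiom schema of specification holds in it: for every $n\in\mathbb{N}=\{1,2,\dots\}$, every $n+3$ mutually distinct variables $v_1,\dots,v_{n+3}$ in $\{x_1,x_2,\dots\}$ and every ZF formula $\psi$ with free occurrences only of (some of) the variables $v_1,\dots,v_{n+2}$, $$D\models(\forall v_1(\dots(\forall v_n(\forall v_{n+1}(\exists v_{n+3}(\forall v_{n+2}((v_{n+2}\in v_{n+3})\leftrightarrow((v_{n+2}\in v_{n+1})\wedge\psi))))))\dots)).$$ For vertices of $D$: $u$ is a $D$-subset of $v$ ($u\subset_D v$) if $N(u)\subseteq N(v)$; $u$ is the singleton $\{v\}_D$ if $u$ is the only vertex with $N(u)=\{v\}$; $u$ is the doubleton $\{v,w\}_D$ if $u$ is the only vertex with $N(u)=\{v,w\}$; $u$ is an ordered pair $\langle v,w\rangle_D$ if $u=\{\{v\}_D,\{v,w\}_D\}_D$ (i.e. there are vertices $s,t$ such that $s$ is the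 singleton $\{v\}_D$, $t$ is the doubleton $\{v,w\}_D$ and $u$ is the doubleton $\{s,t\}_D$). $u$ is a $D$-relation from $v$ to $P(v)$ if every $D$-element of $u$ is an ordered pair $\langle w,w'\rangle_D$ with $wEv$ and $w'\subset_D v$. $u$ is a $D$-function from $v$ to $P(v)$ if it is a $D$-relation from $v$ to $P(v)$ and for every $D$-element $w$ of $v$ there is exactly one ordered pair $\langle w,w'\rangle_D$ that is a $D$-element of $u$. $u$ is a $D$-surjection from $v$ to $P(v)$ if it is a $D$-function from $v$ to $P(v)$ and for every $w'\subset_D v$ there is at least one ordered pair $\langle w,w'\rangle_D$ that is a $D$-element of $u$. Cantor's theorem holds in $D$ ($D$ is Cantor) if for no vertex $u\in V$ there exists a vertex $v\in V$ that is a $D$-surjection from $u$ to $P(u)$. -}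

module Defs where

open import Level using (Level; 0ℓ) renaming (suc to lsuc)
open import Data.Bool using (if_then_else_)
open import Data.Nat using (ℕ; _+_; _≟_; NonZero)
open import Data.Product using (∃; ∃!; ∃-syntax; _×_)
open import Data.Sum using (_⊎_)
open import Data.Vec.Functional using (Vector; init; last; foldr)
open import Function.Bundles using (_⇔_)
open import Function.Definitions using (Injective)
open import Relation.Binary.Core using (Rel)
open import Relation.Binary.PropositionalEquality using (_≡_)
open import Relation.Nullary using (¬_; does)
open import Relation.Unary using (Pred; ｛_｝; _∪_; _∖_; _⊆_; _≐_)

record Digraph (ℓ : Level) : Set (lsuc ℓ) where
  field
    V        : Set ℓ
    E        : Rel V ℓ
    nonempty : V

  N : V → Pred V ℓ
  N u v = E v u

-- The number i stands for the variable x_{i+1}.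
Var : Set
Var = ℕ

infix  9 _∈′_ _=′_
infix  8 ¬′_
infixr 7 _∧′_
infixr 6 _∨′_
infixr 5 _→′_
infix  4 _↔′_

data Formula : Set where
  _∈′_ _=′_           : Var → Var → Formula
  ¬′_                 : Formula → Formula
  _→′_ _↔′_ _∧′_ _∨′_ : Formula → Formula → Formula
  ∃′ ∀′               : Var → Formula → Formula

FreeVars : Formula → Pred Var 0ℓ
FreeVars (x ∈′ y) = ｛ x ｝ ∪ ｛ y ｝
FreeVars (x =′ y) = ｛ x ｝ ∪ ｛ y ｝
FreeVars (¬′ φ)   = FreeVars φ
FreeVars (φ →′ χ) = FreeVars φ ∪ FreeVars χ
FreeVars (φ ↔′ χ) = FreeVars φ ∪ FreeVars χ
FreeVars (φ ∧′ χ) = FreeVars φ ∪ FreeVars χ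
FreeVars (φ ∨′ χ) = FreeVars φ ∪ FreeVars χ
FreeVars (∃′ x φ) = FreeVars φ ∖ ｛ x ｝
FreeVars (∀′ x φ) = FreeVars φ ∖ ｛ x ｝

_[_↦_] : ∀ {ℓ} {A : Set ℓ} → (Var → A) → Var → A → (Var → A)
(σ [ x ↦ a ]) y = if does (x ≟ y) then a else σ y

-- v lists v₁, …, v_{n+3}, so that
--   last v               is v_{n+3},
--   last (init v)        is v_{n+2},
--   last (init (init v)) is v_{n+1},
--   init (init (init v)) lists v₁, …, v_n.
specification : ∀ n → Vector Var (3 + n) → Formula → Formula
specification n v ψ =
  foldr ∀′ (∀′ a (∃′ w (∀′ x ((x ∈′ w) ↔′ ((x ∈′ a) ∧′ ψ)))))
    (init (init (init v)))
  where
  w = last v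
  x = last (init v)
  a = last (init (init v))

module _ {ℓ : Level} (D : Digraph ℓ) where
  open Digraph D

  -- Tarskian satisfaction, with the connectives and quantifiers read as
  -- those of the metatheory; under excluded middle this is the classical
  -- satisfaction relation.
  Sat : (Var → V) → Formula → Set ℓ
  Sat σ (x ∈′ y) = E (σ x) (σ y)
  Sat σ (x =′ y) = σ x ≡ σ y
  Sat σ (¬′ φ)   = ¬ Sat σ φ
  Sat σ (φ →′ χ) = Sat σ φ → Sat σ χ
  Sat σ (φ ↔′ χ) = Sat σ φ ⇔ Sat σ χ
  Sat σ (φ ∧′ χ) = Sat σ φ × Sat σ χ
  Sat σ (φ ∨′ χ) = Sat σ φ ⊎ Sat σ χ
  Sat σ (∃′ x φ) = ∃[ d ] Sat (σ [ x ↦ d ]) φ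
  Sat σ (∀′ x φ) = ∀ d → Sat (σ [ x ↦ d ]) φ

  -- Only used for sentences, whose satisfaction does not depend on σ.
  Models : Formula → Set ℓ
  Models χ = ∀ σ → Sat σ χ

  Extensive : Set ℓ
  Extensive =
    ∀ n .{{_ : NonZero n}} (v : Vector Var (3 + n)) → Injective _≡_ _≡_ v →
    ∀ ψ → FreeVars ψ ⊆ (λ y → ∃[ i ] init v i ≡ y) →
    Models (specification n v ψ)

  _⊂D_ : V → V → Set ℓ
  u ⊂D v = N u ⊆ N v

  IsTheOnlyVertexWith : V → Pred V ℓ → Set ℓ
  IsTheOnlyVertexWith u P = N u ≐ P × (∀ u′ → N u′ ≐ P → u′ ≡ u)

  IsSingleton : V → V → Set ℓ
  IsSingleton u v = IsTheOnlyVertexWith u ｛ v ｝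

  IsDoubleton : V → V → V → Set ℓ
  IsDoubleton u v w = IsTheOnlyVertexWith u (｛ v ｝ ∪ ｛ w ｝)

  IsOrderedPair : V → V → V → Set ℓ
  IsOrderedPair u v w =
    ∃[ s ] ∃[ t ] IsSingleton s v × IsDoubleton t v w × IsDoubleton u s t

  IsRelationToP : V → V → Set ℓ
  IsRelationToP u v =
    ∀ p → E p u → ∃[ w ] ∃[ w′ ] IsOrderedPair p w w′ × E w v × w′ ⊂D v

  -- What is unique is the vertex p, not the pair of p and w′.
  IsFunctionToP : V → V → Set ℓ
  IsFunctionToP u v =
    IsRelationToP u v ×
    (∀ w → E w v → ∃! _≡_ λ p → E p u × ∃[ w′ ] IsOrderedPair p w w′)

  IsSurjectionToP : V → V → Set ℓ
  IsSurjectionToP u v =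
    IsFunctionToP u v ×
    (∀ w′ → w′ ⊂D v → ∃[ p ] E p u × ∃[ w ] IsOrderedPair p w w′)

  Cantor : Set ℓ
  Cantor = ¬ (∃[ u ] ∃[ v ] IsSurjectionToP v u)

{-# OPTIONS --safe #-}
module Submission where

-- Cantor's diagonal argument, read constructively. If f were a D-surjection
-- from u to P(u), specification would give the vertex r whose D-elements are
-- the D-elements x of u whose f-value does not contain x; then r is itself the
-- f-value of some x, and x E r is equivalent to its own negation.

open import Level using (Level)
open import Data.Fin using (zero; suc; toℕ)
open import Data.Fin.Properties using (toℕ-injective)
open import Data.List using (List; []; _∷_; _++_; filter)
open import Data.List.Membership.DecPropositional using (_∈?_)
open import Data.List.Membership.Propositional using (_∈_)
open import Data.List.Membership.Propositional.Properties
  using (∈-filter⁺; ∈-++⁺ˡ; ∈-++⁺ʳ)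
open import Data.List.Relation.Unary.All using (all?; lookup)
open import Data.List.Relation.Unary.Any using (here; there)
open import Data.Nat using (_≟_)
open import Data.Product using (∃-syntax; _×_; _,_; proj₁; proj₂)
open import Data.Sum using (_⊎_; inj₁; inj₂; [_,_]′)
open import Function.Base using (_∘_)
open import Function.Bundles using (_⇔_; module Equivalence)
open import Relation.Binary.PropositionalEquality using (_≡_; refl; sym; trans)
open import Relation.Nullary using (¬_)
open import Relation.Nullary.Decidable using (¬?; from-yes)
open import Relation.Unary using (_⊆_; _∪_)
open import Defs

-- A list, so that a bound on the free variables of a concrete formula can be decided by evaluation.
freeVars : Formula → List Var
freeVars (x ∈′ y) = x ∷ y ∷ []
freeVars (x =′ y) = x ∷ y ∷ []
freeVars (¬′ φ)   = freeVars φ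
freeVars (φ →′ χ) = freeVars φ ++ freeVars χ
freeVars (φ ↔′ χ) = freeVars φ ++ freeVars χ
freeVars (φ ∧′ χ) = freeVars φ ++ freeVars χ
freeVars (φ ∨′ χ) = freeVars φ ++ freeVars χ
freeVars (∃′ x φ) = filter (¬? ∘ (x ≟_)) (freeVars φ)
freeVars (∀′ x φ) = filter (¬? ∘ (x ≟_)) (freeVars φ)

FreeVars⊆freeVars : ∀ φ → FreeVars φ ⊆ (_∈ freeVars φ)

FreeVars-∪⊆ : ∀ φ χ → FreeVars φ ∪ FreeVars χ ⊆ (_∈ freeVars φ ++ freeVars χ)
FreeVars-∪⊆ φ χ = [ ∈-++⁺ˡ ∘ FreeVars⊆freeVars φ
                  , ∈-++⁺ʳ (freeVars φ) ∘ FreeVars⊆freeVars χ ]′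

FreeVars⊆freeVars (x ∈′ y) (inj₁ refl) = here refl
FreeVars⊆freeVars (x ∈′ y) (inj₂ refl) = there (here refl)
FreeVars⊆freeVars (x =′ y) (inj₁ refl) = here refl
FreeVars⊆freeVars (x =′ y) (inj₂ refl) = there (here refl)
FreeVars⊆freeVars (¬′ φ)   = FreeVars⊆freeVars φ
FreeVars⊆freeVars (φ →′ χ) = FreeVars-∪⊆ φ χ
FreeVars⊆freeVars (φ ↔′ χ) = FreeVars-∪⊆ φ χ
FreeVars⊆freeVars (φ ∧′ χ) = FreeVars-∪⊆ φ χ
FreeVars⊆freeVars (φ ∨′ χ) = FreeVars-∪⊆ φ χ
FreeVars⊆freeVars (∃′ x φ) (y∈φ , x≢y) =
  ∈-filter⁺ (¬? ∘ (x ≟_)) (FreeVars⊆freeVars φ y∈φ) x≢y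
FreeVars⊆freeVars (∀′ x φ) (y∈φ , x≢y) =
  ∈-filter⁺ (¬? ∘ (x ≟_)) (FreeVars⊆freeVars φ y∈φ) x≢y

-- The variables 1 and 3 are left for the bounding set and the comprehended set
-- in the instance of specification.
diagonalFormula : Formula
diagonalFormula =
  ∃′ p (p ∈′ f
    ∧′ ∀′ t (t ∈′ p →′ x ∈′ t)
    ∧′ ∃′ z ((∃′ t (t ∈′ p ∧′ z ∈′ t)
        ∧′ ∀′ t (t ∈′ p →′ ∀′ y (y ∈′ t →′ (y =′ x ∨′ y =′ z))))
      ∧′ ¬′ (x ∈′ z)))
  where
  f = 0
  x = 2
  p = 4
  z = 5
  t = 6
  y = 7

FreeVars-diagonalFormula : FreeVars diagonalFormula ⊆ (_∈ 0 ∷ 2 ∷ [])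
FreeVars-diagonalFormula =
  lookup (from-yes (all? (λ y → _∈?_ _≟_ y (0 ∷ 2 ∷ [])) (freeVars diagonalFormula)))
  ∘ FreeVars⊆freeVars diagonalFormula

module _ {ℓ : Level} (D : Digraph ℓ) where
  open Digraph D

  -- Unlike IsOrderedPair, these express the coordinates of an ordered pair
  -- without the uniqueness clauses, so that they have short formulas.
  IsFirst : V → V → Set ℓ
  IsFirst p x = ∀ t → E t p → E x t

  IsSecond : V → V → V → Set ℓ
  IsSecond p x z =
    (∃[ t ] E t p × E z t) × (∀ t → E t p → ∀ y → E y t → y ≡ x ⊎ y ≡ z)

  InDiagonal : V → V → Set ℓ
  InDiagonal f x =
    ∃[ p ] E p f × IsFirst p x × ∃[ z ] IsSecond p x z × ¬ E x z

  diagonal : Extensive D → ∀ f u →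
    ∃[ r ] (∀ x → E x r ⇔ (E x u × InDiagonal f x))
  diagonal extensive f u =
    -- `toℕ` makes the variables 0, 1, 2, 3 stand for `f`, `u`, `x`, `r`; satisfaction then computes
    -- to the stated equivalence. The assignment `λ _ → u` is an arbitrary choice for a sentence.
    extensive 1 toℕ toℕ-injective diagonalFormula
      (listed ∘ FreeVars-diagonalFormula) (λ _ → u) f u
    where
    listed : ∀ {y} → y ∈ 0 ∷ 2 ∷ [] → ∃[ i ] _ ≡ y
    listed (here refl)         = zero , refl
    listed (there (here refl)) = suc (suc zero) , refl

  module _ {p x z : V} (pair : IsOrderedPair D p x z) where
    private
      s   = proj₁ pair
      t   = proj₁ (proj₂ pair)
      s≐  = proj₁ (proj₁ (proj₂ (proj₂ pair)))
      t≐  = proj₁ (proj₁ (proj₂ (proj₂ (proj₂ pair))))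
      p≐  = proj₁ (proj₂ (proj₂ (proj₂ (proj₂ pair))))

    isFirst : IsFirst p x
    isFirst t′ t′∈p with proj₁ p≐ t′∈p
    ... | inj₁ refl = proj₂ s≐ refl
    ... | inj₂ refl = proj₂ t≐ (inj₁ refl)

    -- The singleton of `x` is an element of `p`, so `y` has to lie in it.
    first-unique : ∀ {y} → IsFirst p y → x ≡ y
    first-unique y-first = proj₁ s≐ (y-first s (proj₂ p≐ (inj₁ refl)))

    isSecond : IsSecond p x z
    isSecond = (t , proj₂ p≐ (inj₂ refl) , proj₂ t≐ (inj₂ refl)) , covered
      where
      covered : ∀ t′ → E t′ p → ∀ y → E y t′ → y ≡ x ⊎ y ≡ z
      covered t′ t′∈p y y∈t′ with proj₁ p≐ t′∈p
      ... | inj₁ refl = inj₁ (sym (proj₁ s≐ y∈t′))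
      ... | inj₂ refl with proj₁ t≐ y∈t′
      ...   | inj₁ x≡y = inj₁ (sym x≡y)
      ...   | inj₂ z≡y = inj₂ (sym z≡y)

  -- Each of `z`, `z′` is covered by the other's clause. If neither case gives the equality
  -- directly, both equal `x`: the degenerate pair with equal coordinates.
  second-unique : ∀ {p x z z′} → IsSecond p x z → IsSecond p x z′ → z ≡ z′
  second-unique ((t , t∈p , z∈t) , cover) ((t′ , t′∈p , z′∈t′) , cover′)
    with cover′ t t∈p _ z∈t | cover t′ t′∈p _ z′∈t′
  ... | inj₂ z≡z′ | _         = z≡z′
  ... | inj₁ _    | inj₂ z′≡z = sym z′≡z
  ... | inj₁ z≡x  | inj₁ z′≡x = trans z≡x (sym z′≡x)

  module _ {f u : V} (f-surj : IsSurjectionToP D f u) where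
    private
      relation = proj₁ (proj₁ f-surj)
      function = proj₂ (proj₁ f-surj)

    first∈domain : ∀ {p x} → E p f → IsFirst p x →
      E x u × ∃[ z ] IsOrderedPair D p x z
    first∈domain p∈f x-first with relation _ p∈f
    ... | y , z , pair , y∈u , _ with first-unique pair x-first
    ...   | refl = y∈u , z , pair

    -- By `first∈domain` both are genuine ordered pairs starting with `x`, so both equal the one
    -- vertex that the function clause provides.
    pair-unique : ∀ {p q x} → E p f → IsFirst p x → E q f → IsFirst q x → p ≡ q
    pair-unique p∈f p-first q∈f q-first
      with first∈domain p∈f p-first | first∈domain q∈f q-first
    ... | x∈u , p-pair | _ , q-pair with function _ x∈u
    ...   | _ , _ , unique = trans (sym (unique (p∈f , p-pair))) (unique (q∈f , q-pair))

theorem6p2 : ∀ {ℓ : Level} (D : Digraph ℓ) → Extensive D → Cantor D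
theorem6p2 D extensive (u , f , f-surj) with diagonal D extensive f u
-- `r` is a D-subset of `u`, so some pair `p` in `f` has it as second coordinate.
... | r , r-spec with proj₂ f-surj r (proj₁ ∘ Equivalence.to (r-spec _))
... | p , p∈f , x , pair = x∉r (Equivalence.from (r-spec x) (x∈u , x-diagonal))
  where
  open Digraph D

  x∈u : E x u
  x∈u = proj₁ (first∈domain D f-surj p∈f (isFirst D pair))

  x∉r : ¬ E x r
  x∉r x∈r with proj₂ (Equivalence.to (r-spec x) x∈r)
  ... | q , q∈f , q-first , z , z-second , x∉z
    -- The witnesses `q` and `z` hidden in `x∈r` must be `p` and `r`, which turns `x∉z` into a
    -- refutation of `x∈r` itself.
    with pair-unique D f-surj p∈f (isFirst D pair) q∈f q-first
  ... | refl with second-unique D (isSecond D pair) z-second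
  ... | refl = x∉z x∈r

  x-diagonal : InDiagonal D f x
  x-diagonal = p , p∈f , isFirst D pair , r , isSecond D pair , x∉r
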